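{- Let $\mathbf P=(P,\leq,*,1)$ be a strongly sectionally pseudocomplemented poset and $F$ a subset of $P$ that is closed with respect to the following partial ideal terms: \begin{align*} T_1 & :=1, \\ T_2(x_1,x_2,x_3,y_1,y_2) & :=((U(x_1,x_2)\wedge(y_1*x_2)\wedge y_2)*x_3)*(x_2*x_3), \\ T_3(x_1,x_2,x_3,y_1,y_2) & :=(x_3*x_1)*(x_3*(U(x_1,x_2)\wedge(y_2*x_1)\wedge y_1)), \\ T_4(x_1,x_2,x_3,x_4,y_1,y_2,y_3,y_4) & :=((U(x_1,x_2)\wedge(y_1*x_2)\wedge y_2)\wedge(U(x_3,x_4)\wedge(y_3*x_4)\wedge y_4))*(x_2\wedge x_4). \end{align*} Then $F\in\operatorname{Fil}\mathbf P$.
   Context: For a poset $(P,\leq)$ and $A\subseteq P$, $U(A)$ and $L(A)$ denote the sets of all upper, respectively lower, bounds of $A$; $U(a,b)=U(\{a,b\})$, $L(b)=L(\{b\})$, $L(U(a,b),c)=L(U(a,b)\cup\{c\})$. The poset is sectionally pseudocomplemented if for all $a,b\in P$ there exists a greatest element $c$ of $P$ with $L(U(a,b),c)=L(b)$; this $c$ is denoted by $a*b$, and one writes $(P,\leq,*)$. A strongly sectionally pseudocomplemented poset is a quadruple $(P,\leq,*,1)$ such that $(P,\leq,*)$ is a sectionally pseudocomplemented poset with greatest element $1$ satisfying $x\leq(x*y)*y$ for all $x,y\in P$. A filter of $\mathbf P$ is a subset $F$ of $P$ containing $1$ such that for all $x,y,z,v\in P$: (1) if $x*y,y*x\in F$ then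 $(x*z)*(y*z),(z*x)*(z*y)\in F$; (2) if $x*y,y*x,z*v,v*z\in F$, $x$ and $z$ are comparable and $y$ and $v$ are comparable, then $\min(x,z)*\min(y,v)\in F$. $\operatorname{Fil}\mathbf P$ is the set of all filters of $\mathbf P$. The symbol $\wedge$ denotes the (partially defined) infimum in $(P,\leq)$: $a\wedge b=\inf(a,b)$, and $U(x,y)\wedge z\wedge u$ is the infimum of the set $U(x,y)\cup\{z,u\}$, when it exists. A partial ideal term is a partially defined term $T(x_1,\ldots,x_n,y_1,\ldots,y_m)$ in the language of sectionally pseudocomplemented posets with greatest element $1$ (including also the binary operator $U(x,y)$) satisfying $T(x_1,\ldots,x_n,1,\ldots,1)\approx1$. A subset $A\subseteq P$ is closed with respect to partial ideal terms $T_i(x_1,\ldots,x_n,y_1,\ldots,y_m)$, $i\in I$, if for every $i\in I$, all $x_1,\ldots,x_n\in P$ and all $y_1,\ldots,y_m\in A$, $T_i(x_1,\ldots,x_n,y_1,\ldots,y_m)$ is defined and belongs to $A$ (for $T_1$ this means $1\in A$). -}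

module Defs where

open import Data.Fin using (Fin; zero; suc; #_)
open import Data.Nat.Base using (ℕ)
open import Data.Product using (_×_; _,_; proj₁; proj₂; ∃; ∃₂)
open import Data.Sum using (_⊎_; inj₁; inj₂)
open import Data.Vec.Functional using (Vector)
open import Level using (Level; _⊔_)
open import Relation.Binary.Bundles using (Poset)
open import Relation.Binary.Definitions using (Maximum; _Respects_)
open import Relation.Binary.PropositionalEquality.Core using (refl)
open import Relation.Unary using (Pred; _∈_; _∪_; ｛_｝; _≐_)

private variable
  ℓ   : Level
  n m : ℕ

module Bounds {c ℓ₁ ℓ₂} (P : Poset c ℓ₁ ℓ₂) where
  open Poset P

  U : Pred Carrier ℓ → Pred Carrier (c ⊔ ℓ₂ ⊔ ℓ)
  U A u = ∀ {a} → a ∈ A → a ≤ u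

  L : Pred Carrier ℓ → Pred Carrier (c ⊔ ℓ₂ ⊔ ℓ)
  L A l = ∀ {a} → a ∈ A → l ≤ a

  IsGreatest : Pred Carrier ℓ → Pred Carrier (c ⊔ ℓ₂ ⊔ ℓ)
  IsGreatest A g = g ∈ A × (∀ {a} → a ∈ A → a ≤ g)

  IsInfimum : Pred Carrier ℓ → Pred Carrier (c ⊔ ℓ₂ ⊔ ℓ)
  IsInfimum A i = IsGreatest (L A) i

  Sectional : Carrier → Carrier → Pred Carrier (c ⊔ ℓ₂)
  Sectional a b c = L (U (｛ a ｝ ∪ ｛ b ｝) ∪ ｛ c ｝) ≐ L ｛ b ｝

  Comparable : Carrier → Carrier → Set ℓ₂
  Comparable x y = x ≤ y ⊎ y ≤ x

  min : ∀ {x y} → Comparable x y → Carrier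
  min {x} {y} (inj₁ x≤y) = x
  min {x} {y} (inj₂ y≤x) = y

record StronglySectionallyPseudocomplementedPoset c ℓ₁ ℓ₂
       : Set (Level.suc (c ⊔ ℓ₁ ⊔ ℓ₂)) where
  infixl 7 _*_
  field
    poset : Poset c ℓ₁ ℓ₂
  open Poset poset public
  open Bounds poset public
  field
    _*_    : Carrier → Carrier → Carrier
    1#     : Carrier
    *-sectionalPseudocomplement : ∀ a b → IsGreatest (Sectional a b) (a * b)
    1#-maximum                  : Maximum _≤_ 1#
    strong                      : ∀ x y → x ≤ (x * y) * y

-- Partially defined terms in variables x₁,…,xₙ and y₁,…,yₘ.
-- Infima are taken of set terms, which are built from singletons ⟨ t ⟩ and
-- sets U(s,t); e.g. U(s,t) ∧ z ∧ u is ⋀ (U⟨ s , t ⟩ ∪ˢ ⟨ z ⟩ ∪ˢ ⟨ u ⟩).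

infixl 7 _⋆_
infixl 6 _∧_ _∪ˢ_

mutual
  data Term (n m : ℕ) : Set where
    𝕩   : Fin n → Term n m
    𝕪   : Fin m → Term n m
    𝟏   : Term n m
    _⋆_ : Term n m → Term n m → Term n m
    ⋀   : SetTerm n m → Term n m

  data SetTerm (n m : ℕ) : Set where
    ⟨_⟩    : Term n m → SetTerm n m
    U⟨_,_⟩ : Term n m → Term n m → SetTerm n m
    _∪ˢ_   : SetTerm n m → SetTerm n m → SetTerm n m

_∧_ : Term n m → Term n m → Term n m
s ∧ t = ⋀ (⟨ s ⟩ ∪ˢ ⟨ t ⟩)

T₁-term : Term 0 0
T₁-term = 𝟏

T₂-term : Term 3 2
T₂-term =
  (⋀ (U⟨ x₁ , x₂ ⟩ ∪ˢ ⟨ y₁ ⋆ x₂ ⟩ ∪ˢ ⟨ y₂ ⟩) ⋆ x₃) ⋆ (x₂ ⋆ x₃)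
  where
  x₁ = 𝕩 (# 0); x₂ = 𝕩 (# 1); x₃ = 𝕩 (# 2)
  y₁ = 𝕪 (# 0); y₂ = 𝕪 (# 1)

T₃-term : Term 3 2
T₃-term =
  (x₃ ⋆ x₁) ⋆ (x₃ ⋆ ⋀ (U⟨ x₁ , x₂ ⟩ ∪ˢ ⟨ y₂ ⋆ x₁ ⟩ ∪ˢ ⟨ y₁ ⟩))
  where
  x₁ = 𝕩 (# 0); x₂ = 𝕩 (# 1); x₃ = 𝕩 (# 2)
  y₁ = 𝕪 (# 0); y₂ = 𝕪 (# 1)

T₄-term : Term 4 4
T₄-term =
  (⋀ (U⟨ x₁ , x₂ ⟩ ∪ˢ ⟨ y₁ ⋆ x₂ ⟩ ∪ˢ ⟨ y₂ ⟩)
    ∧ ⋀ (U⟨ x₃ , x₄ ⟩ ∪ˢ ⟨ y₃ ⋆ x₄ ⟩ ∪ˢ ⟨ y₄ ⟩))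
  ⋆ (x₂ ∧ x₄)
  where
  x₁ = 𝕩 (# 0); x₂ = 𝕩 (# 1); x₃ = 𝕩 (# 2); x₄ = 𝕩 (# 3)
  y₁ = 𝕪 (# 0); y₂ = 𝕪 (# 1); y₃ = 𝕪 (# 2); y₄ = 𝕪 (# 3)

module _ {c ℓ₁ ℓ₂} (P : StronglySectionallyPseudocomplementedPoset c ℓ₁ ℓ₂) where
  open StronglySectionallyPseudocomplementedPoset P renaming (refl to ≤-refl)

  private
    ℓᵥ : Level
    ℓᵥ = c ⊔ ℓ₁ ⊔ ℓ₂

  -- ⟦ t ⟧ is the set of values of t under an assignment: it is empty when t
  -- is undefined, and otherwise a single ≈-class (see ⟦⟧-functional).
  -- ⟦ S ⟧ˢ is the set denoted by S, meaningful only when S is Definedˢ.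
  mutual
    ⟦_⟧ : Term n m → Vector Carrier n → Vector Carrier m → Pred Carrier ℓᵥ
    ⟦ 𝕩 i ⟧   xs ys a = Level.Lift ℓᵥ (a ≈ xs i)
    ⟦ 𝕪 j ⟧   xs ys a = Level.Lift ℓᵥ (a ≈ ys j)
    ⟦ 𝟏 ⟧     xs ys a = Level.Lift ℓᵥ (a ≈ 1#)
    ⟦ s ⋆ t ⟧ xs ys a = ∃₂ λ b c →
      b ∈ ⟦ s ⟧ xs ys × c ∈ ⟦ t ⟧ xs ys × a ≈ b * c
    ⟦ ⋀ S ⟧   xs ys a = Definedˢ S xs ys × IsInfimum (⟦ S ⟧ˢ xs ys) a

    Definedˢ : SetTerm n m → Vector Carrier n → Vector Carrier m → Set ℓᵥ
    Definedˢ ⟨ t ⟩      xs ys = ∃ (⟦ t ⟧ xs ys)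
    Definedˢ U⟨ s , t ⟩ xs ys = ∃ (⟦ s ⟧ xs ys) × ∃ (⟦ t ⟧ xs ys)
    Definedˢ (S ∪ˢ S′)  xs ys = Definedˢ S xs ys × Definedˢ S′ xs ys

    ⟦_⟧ˢ : SetTerm n m → Vector Carrier n → Vector Carrier m → Pred Carrier ℓᵥ
    ⟦ ⟨ t ⟩ ⟧ˢ      xs ys = ⟦ t ⟧ xs ys
    ⟦ U⟨ s , t ⟩ ⟧ˢ xs ys = U (⟦ s ⟧ xs ys ∪ ⟦ t ⟧ xs ys)
    ⟦ S ∪ˢ S′ ⟧ˢ    xs ys = ⟦ S ⟧ˢ xs ys ∪ ⟦ S′ ⟧ˢ xs ys

  -- T(x₁,…,xₙ,1,…,1) ≈ 1 is read as: it holds whenever the left side is defined.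
  record PartialIdealTerm : Set ℓᵥ where
    field
      {#x #y} : ℕ
      term    : Term #x #y
      ideal   : ∀ xs {a} → a ∈ ⟦ term ⟧ xs (λ _ → 1#) → a ≈ 1#

  _ClosedUnder_ : {I : Set} → Pred Carrier ℓ → (I → PartialIdealTerm) → Set (ℓᵥ ⊔ ℓ)
  A ClosedUnder T = ∀ i → let open PartialIdealTerm (T i) in
    ∀ (xs : Vector Carrier #x) (ys : Vector Carrier #y) → (∀ j → ys j ∈ A) →
    ∃ λ a → a ∈ ⟦ term ⟧ xs ys × a ∈ A

  -- Subsets of the setoid Carrier are predicates respecting ≈; min x~z picks the
  -- smaller element using the given comparability, as ≤ need not be decidable.
  record IsFilter (F : Pred Carrier ℓ) : Set (ℓᵥ ⊔ ℓ) where
    field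
      respects : F Respects _≈_
      1∈F      : 1# ∈ F
      *-compat : ∀ x y z → x * y ∈ F → y * x ∈ F →
                 (x * z) * (y * z) ∈ F × (z * x) * (z * y) ∈ F
      min-compat : ∀ x y z v →
                   x * y ∈ F → y * x ∈ F → z * v ∈ F → v * z ∈ F →
                   (x~z : Comparable x z) (y~v : Comparable y v) →
                   min x~z * min y~v ∈ F

  Fil : ∀ ℓ → Pred (Pred Carrier ℓ) (ℓᵥ ⊔ ℓ)
  Fil ℓ F = IsFilter F

  *-cong : ∀ {a a′ b b′} → a ≈ a′ → b ≈ b′ → a * b ≈ a′ * b′
  *-cong a≈a′ b≈b′ =
    antisym (half a≈a′ b≈b′) (half (Eq.sym a≈a′) (Eq.sym b≈b′))
    where
    half : ∀ {a a′ b b′} → a ≈ a′ → b ≈ b′ → a * b ≤ a′ * b′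
    half {a} {a′} {b} {b′} a≈a′ b≈b′ =
      proj₂ (*-sectionalPseudocomplement a′ b′) (to , from)
      where
      member = proj₁ (*-sectionalPseudocomplement a b)
      transport : ∀ {u} → u ∈ U (｛ a ｝ ∪ ｛ b ｝) → u ∈ U (｛ a′ ｝ ∪ ｛ b′ ｝)
      transport ub (inj₁ refl) = trans (reflexive (Eq.sym a≈a′)) (ub (inj₁ refl))
      transport ub (inj₂ refl) = trans (reflexive (Eq.sym b≈b′)) (ub (inj₂ refl))
      to : ∀ {l} → l ∈ L (U (｛ a′ ｝ ∪ ｛ b′ ｝) ∪ ｛ a * b ｝) → l ∈ L ｛ b′ ｝
      to lb refl = trans
        (proj₁ member (λ { (inj₁ ub)   → lb (inj₁ (transport ub))
                         ; (inj₂ refl) → lb (inj₂ refl) }) refl)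
        (reflexive b≈b′)
      from : ∀ {l} → l ∈ L ｛ b′ ｝ → l ∈ L (U (｛ a′ ｝ ∪ ｛ b′ ｝) ∪ ｛ a * b ｝)
      from lb (inj₁ ub)   = trans (lb refl) (ub (inj₂ refl))
      from lb (inj₂ refl) = proj₂ member
        (λ { refl → trans (lb refl) (reflexive (Eq.sym b≈b′)) }) (inj₂ refl)

  a*a≈1 : ∀ a → a * a ≈ 1#
  a*a≈1 a = antisym (1#-maximum _)
    (proj₂ (*-sectionalPseudocomplement a a)
      ( (λ { lb refl → lb (inj₁ λ { (inj₁ refl) → ≤-refl ; (inj₂ refl) → ≤-refl }) })
      , (λ { lb (inj₁ ub) → trans (lb refl) (ub (inj₁ refl))
           ; lb (inj₂ refl) → 1#-maximum _ })))

  1*b≈b : ∀ b → 1# * b ≈ b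
  1*b≈b b = antisym
    (proj₁ (proj₁ (*-sectionalPseudocomplement 1# b))
      (λ { (inj₁ ub)   → trans (1#-maximum _) (ub (inj₁ refl))
         ; (inj₂ refl) → reflexive Eq.refl }) refl)
    (proj₂ (*-sectionalPseudocomplement 1# b)
      ( (λ { lb refl → lb (inj₂ refl) })
      , (λ { lb (inj₁ ub) → trans (lb refl) (ub (inj₂ refl))
           ; lb (inj₂ refl) → lb refl })))

  infimum-unique : ∀ {A : Pred Carrier ℓ} {a b} →
                   IsInfimum A a → IsInfimum A b → a ≈ b
  infimum-unique (la , ga) (lb , gb) = antisym (gb la) (ga lb)

  ⟦⟧-functional : ∀ (t : Term n m) xs ys {a b} →
                  a ∈ ⟦ t ⟧ xs ys → b ∈ ⟦ t ⟧ xs ys → a ≈ b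
  ⟦⟧-functional (𝕩 i) xs ys (Level.lift p) (Level.lift q) = Eq.trans p (Eq.sym q)
  ⟦⟧-functional (𝕪 j) xs ys (Level.lift p) (Level.lift q) = Eq.trans p (Eq.sym q)
  ⟦⟧-functional 𝟏     xs ys (Level.lift p) (Level.lift q) = Eq.trans p (Eq.sym q)
  ⟦⟧-functional (s ⋆ t) xs ys (_ , _ , p , q , e) (_ , _ , p′ , q′ , e′) =
    Eq.trans e (Eq.trans
      (*-cong (⟦⟧-functional s xs ys p p′) (⟦⟧-functional t xs ys q q′))
      (Eq.sym e′))
  ⟦⟧-functional (⋀ S) xs ys (_ , p) (_ , q) = infimum-unique p q

  private
    block-value : ∀ (s t u v : Term n m) xs ys {a b} → b ∈ ⟦ t ⟧ xs ys →
      1# ∈ ⟦ u ⟧ xs ys → 1# ∈ ⟦ v ⟧ xs ys →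
      a ∈ ⟦ ⋀ (U⟨ s , t ⟩ ∪ˢ ⟨ u ⋆ t ⟩ ∪ˢ ⟨ v ⟩) ⟧ xs ys → a ≈ b
    block-value s t u v xs ys {a} {b} b∈t 1∈u 1∈v (_ , lower , greatest) = antisym
      (trans (lower (inj₁ (inj₂ (_ , _ , 1∈u , b∈t , Eq.refl))))
             (reflexive (1*b≈b b)))
      (greatest λ
        { (inj₁ (inj₁ ub)) → ub (inj₂ b∈t)
        ; (inj₁ (inj₂ (_ , _ , p , q , e))) → reflexive (Eq.sym (Eq.trans e
            (Eq.trans (*-cong (⟦⟧-functional u xs ys p 1∈u)
                              (⟦⟧-functional t xs ys q b∈t)) (1*b≈b b))))
        ; (inj₂ p) → trans (1#-maximum b)
                           (reflexive (⟦⟧-functional v xs ys 1∈v p)) })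

    block-value′ : ∀ (s t u v : Term n m) xs ys {a b} → b ∈ ⟦ s ⟧ xs ys →
      1# ∈ ⟦ u ⟧ xs ys → 1# ∈ ⟦ v ⟧ xs ys →
      a ∈ ⟦ ⋀ (U⟨ s , t ⟩ ∪ˢ ⟨ u ⋆ s ⟩ ∪ˢ ⟨ v ⟩) ⟧ xs ys → a ≈ b
    block-value′ s t u v xs ys b∈s 1∈u 1∈v ((((ds , dt) , d) , d′) , lower , greatest) =
      block-value t s u v xs ys b∈s 1∈u 1∈v ((((dt , ds) , d) , d′) ,
        (λ { (inj₁ (inj₁ ub)) → lower (inj₁ (inj₁ (λ z → ub (swap z))))
           ; (inj₁ (inj₂ p))  → lower (inj₁ (inj₂ p))
           ; (inj₂ p)         → lower (inj₂ p) }) ,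
        (λ lb → greatest
          (λ { (inj₁ (inj₁ ub)) → lb (inj₁ (inj₁ (λ z → ub (swap z))))
             ; (inj₁ (inj₂ p))  → lb (inj₁ (inj₂ p))
             ; (inj₂ p)         → lb (inj₂ p) })))
      where open Data.Sum using (swap)

  T₁ : PartialIdealTerm
  T₁ = record { term = T₁-term ; ideal = λ _ → Level.lower }

  T₂ : PartialIdealTerm
  T₂ = record { term = T₂-term ; ideal = ideal }
    where
    ideal : ∀ xs {a} → a ∈ ⟦ T₂-term ⟧ xs (λ _ → 1#) → a ≈ 1#
    ideal xs (_ , _ , (_ , _ , w , Level.lift p , e) ,
                      (_ , _ , Level.lift q , Level.lift r , e′) , e″) =
      Eq.trans e″ (Eq.trans
        (*-cong (Eq.trans e (*-cong w≈x₂ p)) (Eq.trans e′ (*-cong q r))) (a*a≈1 _))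
      where
      w≈x₂ = block-value {3} {2} (𝕩 (# 0)) (𝕩 (# 1)) (𝕪 (# 0)) (𝕪 (# 1)) xs (λ _ → 1#)
        (Level.lift Eq.refl) (Level.lift Eq.refl) (Level.lift Eq.refl) w

  T₃ : PartialIdealTerm
  T₃ = record { term = T₃-term ; ideal = ideal }
    where
    ideal : ∀ xs {a} → a ∈ ⟦ T₃-term ⟧ xs (λ _ → 1#) → a ≈ 1#
    ideal xs (_ , _ , (_ , _ , Level.lift p , Level.lift q , e) ,
                      (_ , _ , Level.lift r , w , e′) , e″) =
      Eq.trans e″ (Eq.trans
        (*-cong (Eq.trans e (*-cong p q)) (Eq.trans e′ (*-cong r w≈x₁))) (a*a≈1 _))
      where
      w≈x₁ = block-value′ {3} {2} (𝕩 (# 0)) (𝕩 (# 1)) (𝕪 (# 1)) (𝕪 (# 0)) xs (λ _ → 1#)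
        (Level.lift Eq.refl) (Level.lift Eq.refl) (Level.lift Eq.refl) w

  T₄ : PartialIdealTerm
  T₄ = record { term = T₄-term ; ideal = ideal }
    where
    ideal : ∀ xs {a} → a ∈ ⟦ T₄-term ⟧ xs (λ _ → 1#) → a ≈ 1#
    ideal xs (b , c , (((w₁ , w₁∈) , (w₂ , w₂∈)) , lower , greatest) , (_ , lower′ , greatest′) , e) =
      Eq.trans e (Eq.trans (*-cong b≈c Eq.refl) (a*a≈1 c))
      where
      1s : Vector Carrier 4
      1s _ = 1#
      block₁ : Term 4 4
      block₁ = ⋀ (U⟨ 𝕩 (# 0) , 𝕩 (# 1) ⟩ ∪ˢ ⟨ 𝕪 (# 0) ⋆ 𝕩 (# 1) ⟩ ∪ˢ ⟨ 𝕪 (# 1) ⟩)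
      value₁ : ∀ {w} → w ∈ ⟦ block₁ ⟧ xs 1s → w ≈ xs (# 1)
      value₁ = block-value {4} {4} (𝕩 (# 0)) (𝕩 (# 1)) (𝕪 (# 0)) (𝕪 (# 1)) xs 1s
        (Level.lift Eq.refl) (Level.lift Eq.refl) (Level.lift Eq.refl)
      block₂ : Term 4 4
      block₂ = ⋀ (U⟨ 𝕩 (# 2) , 𝕩 (# 3) ⟩ ∪ˢ ⟨ 𝕪 (# 2) ⋆ 𝕩 (# 3) ⟩ ∪ˢ ⟨ 𝕪 (# 3) ⟩)
      value₂ : ∀ {w} → w ∈ ⟦ block₂ ⟧ xs 1s → w ≈ xs (# 3)
      value₂ = block-value {4} {4} (𝕩 (# 2)) (𝕩 (# 3)) (𝕪 (# 2)) (𝕪 (# 3)) xs 1s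
        (Level.lift Eq.refl) (Level.lift Eq.refl) (Level.lift Eq.refl)
      b≈c : b ≈ c
      b≈c = antisym
        (greatest′ λ
          { (inj₁ (Level.lift p)) → trans (lower (inj₁ w₁∈))
              (reflexive (Eq.trans (value₁ w₁∈) (Eq.sym p)))
          ; (inj₂ (Level.lift p)) → trans (lower (inj₂ w₂∈))
              (reflexive (Eq.trans (value₂ w₂∈) (Eq.sym p))) })
        (greatest λ
          { (inj₁ w) → trans (lower′ (inj₁ (Level.lift Eq.refl)))
              (reflexive (Eq.sym (value₁ w)))
          ; (inj₂ w) → trans (lower′ (inj₂ (Level.lift Eq.refl)))
              (reflexive (Eq.sym (value₂ w))) })

  T₁₋₄ : Fin 4 → PartialIdealTerm
  T₁₋₄ zero                   = T₁
  T₁₋₄ (suc zero)             = T₂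
  T₁₋₄ (suc (suc zero))       = T₃
  T₁₋₄ (suc (suc (suc zero))) = T₄

{-# OPTIONS --safe #-}

-- For all x and y, x is the infimum of U(x,y) ∪ {(x*y)*y, y*x}: it is a lower
-- bound because x ≤ (x*y)*y (strongness) and x ≤ y*x, and the greatest one
-- because L(U(y,x), y*x) = L(x). Hence T₂ and T₃ at (x,y,z,x*y,y*x) are
-- (x*z)*(y*z) and (z*x)*(z*y), and T₄ at (x,y,z,v,x*y,y*x,z*v,v*z) is
-- (x∧z)*(y∧v), so the filter conditions are instances of closedness.
module Submission where

open import Defs
open import Data.Fin using (zero; suc; #_)
open import Data.Nat.Base using (ℕ)
open import Data.Product using (_,_; proj₁; proj₂)
open import Data.Sum using (inj₁; inj₂; swap)
open import Data.Vec.Functional using (Vector; []; _∷_)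
open import Level using (lift)
open import Relation.Unary using (Pred; _∈_; _⊆_; _∪_; ｛_｝; _≐_)
open import Relation.Binary.Definitions using (_Respects_)
open import Relation.Binary.PropositionalEquality.Core using (refl)

module _ {c ℓ₁ ℓ₂} (P : StronglySectionallyPseudocomplementedPoset c ℓ₁ ℓ₂) where
  open StronglySectionallyPseudocomplementedPoset P renaming (refl to ≤-refl)

  -- Every element of `U(y,x)` lies above `x`, so `L(U(y,x), x) = L(x)`: thus `x` is itself one of
  -- the elements among which `y * x` is greatest.
  x≤y*x : ∀ x y → x ≤ y * x
  x≤y*x x y = proj₂ (*-sectionalPseudocomplement y x)
    ( (λ { lb refl → lb (inj₂ refl) })
    , (λ { lb (inj₁ ub)   → trans (lb refl) (ub (inj₂ refl))
         ; lb (inj₂ refl) → lb refl }))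

  IsInfimum-resp-≐ : ∀ {a b} {A : Pred Carrier a} {B : Pred Carrier b} {i} →
                     A ≐ B → IsInfimum A i → IsInfimum B i
  IsInfimum-resp-≐ (A⊆B , B⊆A) (lower , greatest) =
    (λ b∈B → lower (B⊆A b∈B)) , (λ lb → greatest (λ a∈A → lb (A⊆B a∈A)))

  min-isInfimum : ∀ {x y} (x~y : Comparable x y) → IsInfimum (｛ x ｝ ∪ ｛ y ｝) (min x~y)
  min-isInfimum (inj₁ x≤y) =
    (λ { (inj₁ refl) → ≤-refl ; (inj₂ refl) → x≤y }) , (λ lb → lb (inj₁ refl))
  min-isInfimum (inj₂ y≤x) =
    (λ { (inj₁ refl) → y≤x ; (inj₂ refl) → ≤-refl }) , (λ lb → lb (inj₂ refl))

  module _ {n m : ℕ} (xs : Vector Carrier n) (ys : Vector Carrier m) where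

    private
      Val : Term n m → Pred Carrier _
      Val t = ⟦_⟧ P t xs ys

    𝕩-value : ∀ i → xs i ∈ Val (𝕩 i)
    𝕩-value i = lift Eq.refl

    𝕪-value : ∀ j → ys j ∈ Val (𝕪 j)
    𝕪-value j = lift Eq.refl

    ⋆-value : ∀ s t {a b} → a ∈ Val s → b ∈ Val t → a * b ∈ Val (s ⋆ t)
    ⋆-value s t a∈s b∈t = _ , _ , a∈s , b∈t , Eq.refl

    -- Comparability makes the infimum exist. It ranges over all values of `s` and `t`, not just `a`
    -- and `b`; these form single `≈`-classes, so `⟦⟧-functional` carries the bounds over.
    ∧-value : ∀ s t {a b} → a ∈ Val s → b ∈ Val t →
              (a~b : Comparable a b) → min a~b ∈ Val (s ∧ t)
    ∧-value s t a∈s b∈t a~b =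
      let lower , greatest = min-isInfimum a~b in
      ((_ , a∈s) , (_ , b∈t)) ,
      (λ { (inj₁ p) → trans (lower (inj₁ refl)) (reflexive (⟦⟧-functional P s xs ys a∈s p))
         ; (inj₂ p) → trans (lower (inj₂ refl)) (reflexive (⟦⟧-functional P t xs ys b∈t p)) }) ,
      (λ lb → greatest (λ { (inj₁ refl) → lb (inj₁ a∈s)
                          ; (inj₂ refl) → lb (inj₂ b∈t) }))

    -- Indices are left free so that exchanging the roles of the two variables, or passing to the
    -- second block of `T₄`, is only a change of indices.
    block-value : ∀ i j k l → ys k ≈ xs i * xs j → ys l ≈ xs j * xs i →
                  xs i ∈ Val (⋀ (U⟨ 𝕩 i , 𝕩 j ⟩ ∪ˢ ⟨ 𝕪 k ⋆ 𝕩 j ⟩ ∪ˢ ⟨ 𝕪 l ⟩))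
    block-value i j k l yₖ≈xᵢxⱼ yₗ≈xⱼxᵢ =
      ((((_ , 𝕩-value i) , (_ , 𝕩-value j)) , (_ , xᵢxⱼxⱼ∈)) , (_ , 𝕪-value l)) ,
      (λ { (inj₁ (inj₁ ub)) → ub (inj₁ (𝕩-value i))
         ; (inj₁ (inj₂ p))  → trans (strong (xs i) (xs j))
             (reflexive (⟦⟧-functional P (𝕪 k ⋆ 𝕩 j) xs ys xᵢxⱼxⱼ∈ p))
         ; (inj₂ (lift p))  → trans (x≤y*x (xs i) (xs j))
             (reflexive (Eq.sym (Eq.trans p yₗ≈xⱼxᵢ))) }) ,
      -- A lower bound of the block lies below all of `U(xs j, xs i)` and below `xs j * xs i`, hence
      -- below `xs i` by the defining property of `xs j * xs i`.
      (λ lb → proj₁ (proj₁ (*-sectionalPseudocomplement (xs j) (xs i)))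
        (λ { (inj₁ ub)   → lb (inj₁ (inj₁ λ
               { (inj₁ (lift p)) → trans (reflexive p) (ub (inj₂ refl))
               ; (inj₂ (lift p)) → trans (reflexive p) (ub (inj₁ refl)) }))
           ; (inj₂ refl) → trans (lb (inj₂ (𝕪-value l))) (reflexive yₗ≈xⱼxᵢ) })
        refl)
      where
      xᵢxⱼxⱼ∈ : (xs i * xs j) * xs j ∈ Val (𝕪 k ⋆ 𝕩 j)
      xᵢxⱼxⱼ∈ = ⋆-value (𝕪 k) (𝕩 j) (lift (Eq.sym yₖ≈xᵢxⱼ)) (𝕩-value j)

    -- Needed for `T₃`, whose block has the roles of `x₁` and `x₂` exchanged everywhere except in
    -- the order of the arguments of `U`.
    U-swap : ∀ s t S S′ {a} → a ∈ Val (⋀ (U⟨ s , t ⟩ ∪ˢ S ∪ˢ S′)) →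
             a ∈ Val (⋀ (U⟨ t , s ⟩ ∪ˢ S ∪ˢ S′))
    U-swap s t S S′ ((((ds , dt) , dS) , dS′) , inf) =
      (((dt , ds) , dS) , dS′) , IsInfimum-resp-≐ (∪ˢ-swap s t , ∪ˢ-swap t s) inf
      where
      ∪ˢ-swap : ∀ s t → ⟦_⟧ˢ P (U⟨ s , t ⟩ ∪ˢ S ∪ˢ S′) xs ys ⊆
                        ⟦_⟧ˢ P (U⟨ t , s ⟩ ∪ˢ S ∪ˢ S′) xs ys
      ∪ˢ-swap s t (inj₁ (inj₁ ub)) = inj₁ (inj₁ (λ p → ub (swap p)))
      ∪ˢ-swap s t (inj₁ (inj₂ p))  = inj₁ (inj₂ p)
      ∪ˢ-swap s t (inj₂ p)         = inj₂ p

theorem4p13 : ∀ {c ℓ₁ ℓ₂ ℓ} (P : StronglySectionallyPseudocomplementedPoset c ℓ₁ ℓ₂) →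
    let open StronglySectionallyPseudocomplementedPoset P in
    (F : Pred Carrier ℓ) → F Respects _≈_ →
    _ClosedUnder_ P F (T₁₋₄ P) → F ∈ Fil P ℓ
theorem4p13 P F resp closed = record
  { respects   = resp
  ; 1∈F        = 1∈F
  ; *-compat   = λ x y z p q → T₂-closed x y z p q , T₃-closed x y z p q
  ; min-compat = T₄-closed
  }
  where
  open StronglySectionallyPseudocomplementedPoset P hiding (refl)

  -- Closedness only supplies some value in `F`. Values are unique up to `≈` and `F` respects `≈`,
  -- so it suffices to exhibit the desired element as a value of the term.
  value : ∀ i xs ys → (∀ j → ys j ∈ F) →
          ∀ {b} → b ∈ ⟦_⟧ P (PartialIdealTerm.term (T₁₋₄ P i)) xs ys → b ∈ F
  value i xs ys ys∈F b∈t =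
    let _ , a∈t , a∈F = closed i xs ys ys∈F
    in resp (⟦⟧-functional P (PartialIdealTerm.term (T₁₋₄ P i)) xs ys a∈t b∈t) a∈F

  1∈F : 1# ∈ F
  1∈F = value (# 0) [] [] (λ ()) (lift Eq.refl)

  T₂-closed : ∀ x y z → x * y ∈ F → y * x ∈ F → (x * z) * (y * z) ∈ F
  T₂-closed x y z p q =
    value (# 1) xs ys (λ { zero → p ; (suc zero) → q })
      (⋆-value P xs ys (block ⋆ 𝕩 (# 2)) (𝕩 (# 1) ⋆ 𝕩 (# 2))
        (⋆-value P xs ys block (𝕩 (# 2))
          (block-value P xs ys (# 0) (# 1) (# 0) (# 1) Eq.refl Eq.refl)
          (𝕩-value P xs ys (# 2)))
        (⋆-value P xs ys (𝕩 (# 1)) (𝕩 (# 2)) (𝕩-value P xs ys (# 1)) (𝕩-value P xs ys (# 2))))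
    where
    xs = x ∷ y ∷ z ∷ []
    ys = x * y ∷ y * x ∷ []
    block : Term 3 2
    block = ⋀ (U⟨ 𝕩 (# 0) , 𝕩 (# 1) ⟩ ∪ˢ ⟨ 𝕪 (# 0) ⋆ 𝕩 (# 1) ⟩ ∪ˢ ⟨ 𝕪 (# 1) ⟩)

  T₃-closed : ∀ x y z → x * y ∈ F → y * x ∈ F → (z * x) * (z * y) ∈ F
  T₃-closed x y z p q =
    value (# 2) xs ys (λ { zero → p ; (suc zero) → q })
      (⋆-value P xs ys (𝕩 (# 2) ⋆ 𝕩 (# 0)) (𝕩 (# 2) ⋆ block)
        (⋆-value P xs ys (𝕩 (# 2)) (𝕩 (# 0)) (𝕩-value P xs ys (# 2)) (𝕩-value P xs ys (# 0)))
        (⋆-value P xs ys (𝕩 (# 2)) block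
          (𝕩-value P xs ys (# 2))
          -- With `x` and `y` exchanged, the block evaluates to `y` instead of `x`.
          (U-swap P xs ys (𝕩 (# 1)) (𝕩 (# 0)) ⟨ 𝕪 (# 1) ⋆ 𝕩 (# 0) ⟩ ⟨ 𝕪 (# 0) ⟩
            (block-value P xs ys (# 1) (# 0) (# 1) (# 0) Eq.refl Eq.refl))))
    where
    xs = x ∷ y ∷ z ∷ []
    ys = x * y ∷ y * x ∷ []
    block : Term 3 2
    block = ⋀ (U⟨ 𝕩 (# 0) , 𝕩 (# 1) ⟩ ∪ˢ ⟨ 𝕪 (# 1) ⋆ 𝕩 (# 0) ⟩ ∪ˢ ⟨ 𝕪 (# 0) ⟩)

  T₄-closed : ∀ x y z v → x * y ∈ F → y * x ∈ F → z * v ∈ F → v * z ∈ F →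
              (x~z : Comparable x z) (y~v : Comparable y v) → min x~z * min y~v ∈ F
  T₄-closed x y z v p q r s x~z y~v =
    value (# 3) xs ys
      (λ { zero → p ; (suc zero) → q ; (suc (suc zero)) → r ; (suc (suc (suc zero))) → s })
      (⋆-value P xs ys (block₁ ∧ block₂) (𝕩 (# 1) ∧ 𝕩 (# 3))
        -- The blocks evaluate to `x` and `z`, so `x~z` settles their meet.
        (∧-value P xs ys block₁ block₂
          (block-value P xs ys (# 0) (# 1) (# 0) (# 1) Eq.refl Eq.refl)
          (block-value P xs ys (# 2) (# 3) (# 2) (# 3) Eq.refl Eq.refl) x~z)
        (∧-value P xs ys (𝕩 (# 1)) (𝕩 (# 3)) (𝕩-value P xs ys (# 1)) (𝕩-value P xs ys (# 3)) y~v))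
    where
    xs = x ∷ y ∷ z ∷ v ∷ []
    ys = x * y ∷ y * x ∷ z * v ∷ v * z ∷ []
    block₁ block₂ : Term 4 4
    block₁ = ⋀ (U⟨ 𝕩 (# 0) , 𝕩 (# 1) ⟩ ∪ˢ ⟨ 𝕪 (# 0) ⋆ 𝕩 (# 1) ⟩ ∪ˢ ⟨ 𝕪 (# 1) ⟩)
    block₂ = ⋀ (U⟨ 𝕩 (# 2) , 𝕩 (# 3) ⟩ ∪ˢ ⟨ 𝕪 (# 2) ⋆ 𝕩 (# 3) ⟩ ∪ˢ ⟨ 𝕪 (# 3) ⟩)
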